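{- Let $T$ be a tree of order $n \geq 4$ with maximum degree $\Delta(T) \geq 3$. Then $$hc(T) \geq (n-1)(n-1-\varepsilon(T)) + \varepsilon'(T) - 2\mathcal{L}(T).$$
   Context: For a connected graph $G$ of order $n$ (finite, simple), $D(u,v)$ denotes the detour distance between vertices $u,v$, i.e. the length of a longest $u,v$-path in $G$ (for a tree this is the ordinary distance). A hamiltonian coloring of $G$ is a map $c: V(G)\to\{0,1,2,\dots\}$ such that $D(u,v)+|c(u)-c(v)|\geq n-1$ for every two distinct vertices $u,v$. The value $hc(c)$ is the maximum color assigned by $c$, and the hamiltonian chromatic number $hc(G)$ is the minimum of $hc(c)$ over all hamiltonian colorings $c$ of $G$ (note that the color $0$ is allowed). For a tree $T$, the center $C(T)$ is the set of vertices of minimum eccentricity; it consists of either one vertex $w$ or two adjacent vertices $w,w'$ (the central vertex/vertices). For $u\in V(T)$ put $\mathcal{L}(u)=\min\{D(u,w): w\in C(T)\}$ (the detour level), and $\mathcal{L}(T)=\sum_{u\in V(T)}\mathcal{L}(u)$ (the total detour level). Put $\varepsilon(T)=0$ if $|C(T)|=1$, $\varepsilon(T)=1$ if $|C(T)|=2$, and $\varepsilon'(T)=1-\varepsilon(T)$. -}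

module Defs where

open import Algebra.Properties.CommutativeMonoid.Sum
open import Data.Bool.Base using (if_then_else_)
open import Data.Fin.Base using (Fin; zero; suc; toℕ; fromℕ<; finToFun; funToFin)
open import Data.Fin.Properties as Fin
  using (any?; all?; toℕ-injective; toℕ-fromℕ<; finToFun-funToFin; injective⇒≤)
open import Data.List.Base as List using (List; []; _∷_; allFin; filter; lookup)
open import Data.List.Membership.Propositional.Properties using (∈-lookup)
import Data.List.Relation.Unary.All as All
open import Data.List.Relation.Unary.Unique.Propositional using (Unique; _∷_)
open import Data.List.Relation.Unary.Unique.DecPropositional using (unique?)
open import Data.Nat.Base
open import Data.Nat.Properties as ℕ hiding (_≟_)
open import Data.Product.Base using (Σ; ∃; _×_; _,_; proj₁; proj₂; ∃-syntax)
import Data.Vec.Functional as Vector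
open import Function.Base using (_∘_)
open import Level using (0ℓ)
open import Relation.Binary.Construct.Closure.ReflexiveTransitive using (Star; ε; _◅_)
open import Relation.Binary.Core using (Rel)
open import Relation.Binary.Definitions as B using (Symmetric)
open import Relation.Binary.PropositionalEquality
open import Relation.Nullary using (Dec; yes; no; ¬_; contradiction)
open import Relation.Nullary.Decidable using (map′; _×-dec_; does)
open import Relation.Unary using (Pred; Decidable)

IsLeast IsGreatest : Pred ℕ 0ℓ → Pred ℕ 0ℓ
IsLeast    P m = P m × (∀ k → P k → m ≤ k)
IsGreatest P m = P m × (∀ k → P k → k ≤ m)

module _ {P : Pred ℕ 0ℓ} (P? : Decidable P) where

  private
    search↑ : ∀ fuel m → (∀ k → P k → m ≤ k) → P (fuel + m) → ∃ (IsLeast P)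
    search↑ zero       m lb Pm = m , Pm , lb
    search↑ (suc fuel) m lb Pf with P? m
    ... | yes Pm = m , Pm , lb
    ... | no ¬Pm = search↑ fuel (suc m)
      (λ k Pk → ≤∧≢⇒< (lb k Pk) (λ { refl → ¬Pm Pk }))
      (subst P (sym (+-suc fuel m)) Pf)

    search↓ : ∀ m → (∀ k → P k → k ≤ m) → ∃ P → ∃ (IsGreatest P)
    search↓ m ub (k , Pk) with P? m
    ... | yes Pm = m , Pm , ub
    search↓ zero    ub (k , Pk) | no ¬Pm =
      contradiction (subst P (n≤0⇒n≡0 (ub k Pk)) Pk) ¬Pm
    search↓ (suc m) ub (k , Pk) | no ¬Pm =
      search↓ m (λ j Pj → s≤s⁻¹ (≤∧≢⇒< (ub j Pj) (λ { refl → ¬Pm Pj }))) (k , Pk)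

  least : ∃ P → ∃ (IsLeast P)
  least (k , Pk) = search↑ k 0 (λ _ _ → z≤n) (subst P (sym (+-identityʳ k)) Pk)

  greatest : ∀ m → (∀ k → P k → k ≤ m) → ∃ P → ∃ (IsGreatest P)
  greatest = search↓

lookup-injective : ∀ {A : Set} {xs : List A} → Unique xs →
                   ∀ i j → lookup xs i ≡ lookup xs j → i ≡ j
lookup-injective (_ ∷ _)  zero    zero    _  = refl
lookup-injective (x ∷ _)  zero    (suc j) eq = contradiction eq (All.lookup x (∈-lookup j))
lookup-injective (x ∷ _)  (suc i) zero    eq = contradiction (sym eq) (All.lookup x (∈-lookup i))
lookup-injective (_ ∷ xs) (suc i) (suc j) eq = cong suc (lookup-injective xs i j eq)

maximum : ∀ {n} → (Fin n → ℕ) → ℕ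
maximum = Vector.foldr _⊔_ 0

≤-maximum : ∀ {n} (f : Fin n → ℕ) i → f i ≤ maximum f
≤-maximum f zero    = m≤m⊔n _ _
≤-maximum f (suc i) = ≤-trans (≤-maximum (f ∘ suc) i) (m≤n⊔m (f zero) _)

maximum-cong : ∀ {n} {f g : Fin n → ℕ} → f ≗ g → maximum f ≡ maximum g
maximum-cong {zero}  f≗g = refl
maximum-cong {suc n} f≗g = cong₂ _⊔_ (f≗g zero) (maximum-cong (f≗g ∘ suc))

record Graph (n : ℕ) : Set₁ where
  infix 4 _~_ _~?_
  field
    _~_      : Rel (Fin n) 0ℓ
    _~?_     : B.Decidable _~_
    ~-sym    : Symmetric _~_
    ~-irrefl : ∀ u → ¬ (u ~ u)

  Walk : Rel (Fin n) 0ℓ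
  Walk = Star _~_

  length : ∀ {u v} → Walk u v → ℕ
  length ε       = 0
  length (_ ◅ w) = suc (length w)

  vertices : ∀ {u v} → Walk u v → List (Fin n)
  vertices {u} ε       = u ∷ []
  vertices {u} (_ ◅ w) = u ∷ vertices w

  IsPath : ∀ {u v} → Walk u v → Set
  IsPath w = Unique (vertices w)

  PathOfLength : Fin n → Fin n → Pred ℕ 0ℓ
  PathOfLength u v k = Σ (Walk u v) λ w → IsPath w × length w ≡ k

  Connected : Set
  Connected = ∀ u v → ∃ (PathOfLength u v)

  -- A cycle is a path with at least three vertices whose ends are adjacent.
  Acyclic : Set
  Acyclic = ∀ {u v} (w : Walk u v) → IsPath w → length w ≥ 2 → ¬ (v ~ u)

  degree : Fin n → ℕ
  degree u = List.length (filter (u ~?_) (allFin n))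

  Δ : ℕ
  Δ = maximum degree

  private
    anyWalk? : ∀ {Q : Pred (List (Fin n)) 0ℓ} → Decidable Q → ∀ u v k →
               Dec (Σ (Walk u v) λ w → Q (vertices w) × length w ≡ k)
    anyWalk? Q? u v zero with u Fin.≟ v
    ... | no u≢v = no λ { (ε , _) → u≢v refl }
    ... | yes refl = map′ (λ q → ε , q , refl) (λ { (ε , q , _) → q }) (Q? (u ∷ []))
    anyWalk? Q? u v (suc k) = map′
      (λ { (x , e , w , q , l) → e ◅ w , q , cong suc l })
      (λ { (e ◅ w , q , l) → _ , e , w , q , suc-injective l })
      (any? λ x → (u ~? x) ×-dec anyWalk? (λ xs → Q? (u ∷ xs)) x v k)

  length-vertices : ∀ {u v} (w : Walk u v) → List.length (vertices w) ≡ suc (length w)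
  length-vertices ε       = refl
  length-vertices (_ ◅ w) = cong suc (length-vertices w)

  pathOfLength? : ∀ u v → Decidable (PathOfLength u v)
  pathOfLength? = anyWalk? (unique? Fin._≟_)

  path-bounded : ∀ {u v} k → PathOfLength u v k → k ≤ n
  path-bounded k (w , path , refl) =
    <⇒≤ (subst (_≤ n) (length-vertices w)
      (injective⇒≤ (λ {i} {j} → lookup-injective path i j)))

record ConnectedGraph (n : ℕ) : Set₁ where
  field
    graph     : Graph n
    connected : Graph.Connected graph
  open Graph graph public

  D-exists : ∀ u v → ∃ (IsGreatest (PathOfLength u v))
  D-exists u v = greatest (pathOfLength? u v) n path-bounded (connected u v)

  D : Fin n → Fin n → ℕ
  D u v = proj₁ (D-exists u v)

  IsHamiltonianColoring : (Fin n → ℕ) → Set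
  IsHamiltonianColoring c = ∀ u v → u ≢ v → D u v + ∣ c u - c v ∣ ≥ n ∸ 1

  HamiltonianColoringWithMaximum : Pred ℕ 0ℓ
  HamiltonianColoringWithMaximum h =
    ∃[ c ] IsHamiltonianColoring c × maximum c ≡ h

  private
    isHamiltonianColoring? : Decidable IsHamiltonianColoring
    isHamiltonianColoring? c = all? λ u → all? λ v → impl? u v
      where
      impl? : ∀ u v → Dec (u ≢ v → D u v + ∣ c u - c v ∣ ≥ n ∸ 1)
      impl? u v with u Fin.≟ v
      ... | yes u≡v = yes (contradiction u≡v)
      ... | no  u≢v = map′ (λ p _ → p) (λ f → f u≢v) (n ∸ 1 ≤? _)

    coloring-resp : ∀ {c d} → c ≗ d → IsHamiltonianColoring c → IsHamiltonianColoring d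
    coloring-resp c≗d ham u v u≢v =
      subst₂ (λ a b → D u v + ∣ a - b ∣ ≥ n ∸ 1) (c≗d u) (c≗d v) (ham u v u≢v)

    withMaximum? : Decidable HamiltonianColoringWithMaximum
    withMaximum? h = map′
      (λ (k , p) → decode h k , p)
      (λ { (c , ham , refl) → encode c , coloring-resp (encoded c) ham
                            , sym (maximum-cong (encoded c)) })
      (any? λ k → isHamiltonianColoring? (decode h k) ×-dec (maximum (decode h k) ℕ.≟ h))
      where
      decode : ∀ b → Fin (suc b ^ n) → Fin n → ℕ
      decode b k i = toℕ (finToFun {suc b} {n} k i)

      bounded : (c : Fin n → ℕ) → Fin n → Fin (suc (maximum c))
      bounded c i = fromℕ< (s≤s (≤-maximum c i))

      encode : (c : Fin n → ℕ) → Fin (suc (maximum c) ^ n)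
      encode c = funToFin (bounded c)

      encoded : ∀ c → c ≗ decode (maximum c) (encode c)
      encoded c i = sym (trans (cong toℕ (finToFun-funToFin (bounded c) i)) (toℕ-fromℕ< _))

    someColoring : ∃ HamiltonianColoringWithMaximum
    someColoring = _ , (λ i → toℕ i * (n ∸ 1)) , ham , refl
      where
      open ≤-Reasoning
      ham : IsHamiltonianColoring (λ i → toℕ i * (n ∸ 1))
      ham u v u≢v = begin
        n ∸ 1
          ≡⟨ *-identityˡ (n ∸ 1) ⟨
        1 * (n ∸ 1)
          ≤⟨ *-monoˡ-≤ (n ∸ 1) (n≢0⇒n>0 (u≢v ∘ toℕ-injective ∘ ∣m-n∣≡0⇒m≡n)) ⟩
        ∣ toℕ u - toℕ v ∣ * (n ∸ 1)
          ≡⟨ *-distribʳ-∣-∣ (n ∸ 1) (toℕ u) (toℕ v) ⟩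
        ∣ toℕ u * (n ∸ 1) - toℕ v * (n ∸ 1) ∣
          ≤⟨ m≤n+m _ (D u v) ⟩
        D u v + ∣ toℕ u * (n ∸ 1) - toℕ v * (n ∸ 1) ∣ ∎

  hc-exists : ∃ (IsLeast HamiltonianColoringWithMaximum)
  hc-exists = least withMaximum? someColoring

  hc : ℕ
  hc = proj₁ hc-exists

record Tree (n : ℕ) : Set₁ where
  field
    connectedGraph : ConnectedGraph n
    acyclic        : Graph.Acyclic (ConnectedGraph.graph connectedGraph)
  open ConnectedGraph connectedGraph public

  -- Paths between two given vertices of a tree are unique, so D is also the
  -- ordinary distance, and this is the usual eccentricity.
  eccentricity : Fin n → ℕ
  eccentricity u = maximum (D u)

  Central : Pred (Fin n) 0ℓ
  Central w = ∀ v → eccentricity w ≤ eccentricity v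

  central? : Decidable Central
  central? w = all? λ v → eccentricity w ≤? eccentricity v

  center : List (Fin n)
  center = filter central? (allFin n)

  center-nonempty : Fin n → ∃ Central
  center-nonempty u with least attained? (_ , u , refl)
    where
    attained? : Decidable (λ k → ∃[ v ] eccentricity v ≡ k)
    attained? k = any? λ v → eccentricity v ℕ.≟ k
  ... | _ , (w , refl) , lb = w , λ v → lb _ (v , refl)

  DistanceToCentral : Fin n → Pred ℕ 0ℓ
  DistanceToCentral u k = ∃[ w ] Central w × D u w ≡ k

  level-exists : ∀ u → ∃ (IsLeast (DistanceToCentral u))
  level-exists u = least
    (λ k → any? λ w → central? w ×-dec (D u w ℕ.≟ k))
    (let w , central = center-nonempty u in D u w , w , central , refl)

  level : Fin n → ℕ
  level u = proj₁ (level-exists u)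

  totalLevel : ℕ
  totalLevel = sum +-0-commutativeMonoid level

  -- The center of a tree has one or two elements.
  εᵀ : ℕ
  εᵀ = if does (List.length center ℕ.≟ 2) then 1 else 0

  εᵀ′ : ℕ
  εᵀ′ = 1 ∸ εᵀ

{-# OPTIONS --safe #-}
module Submission where

-- Order the vertices by color as x₀, …, x_{n-1}. Summing
-- c(x_{i+1}) - c(x_i) ≥ n - 1 - D(x_i, x_{i+1}) telescopes, and each detour
-- distance is at most 𝓛(x_i) + 𝓛(x_{i+1}) + ε, because in a tree D satisfies
-- the triangle inequality and any two central vertices are within ε of each
-- other. Every level is thereby counted twice, except those of x₀ and x_{n-1};
-- applying the same bound to 1 ≤ D(x₀, x_{n-1}) shows that these two add up to
-- at least ε′.

open import Defs
open import Algebra.Properties.CommutativeMonoid.Sum using (sum)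
open import Data.Bool.Base using (if_then_else_)
open import Data.Fin.Base using (Fin; zero; suc)
import Data.Fin.Properties as Fin
open import Data.Integer.Base using (+_; 1ℤ; _+_; _-_; _*_; _≥_)
import Data.Integer.Base as ℤ
import Data.Integer.Properties as ℤ
import Data.Integer.Tactic.RingSolver as ℤ-Solver
open import Data.List.Base as List using (List; []; _∷_; allFin)
import Data.List.Membership.DecPropositional as DecMembership
open import Data.List.Membership.Propositional using (_∈_; _∉_)
open import Data.List.Membership.Propositional.Properties using (∈-allFin; ∈-filter⁺; ∈-filter⁻)
open import Data.List.Properties using (map-tabulate; length-tabulate)
open import Data.List.Relation.Binary.Permutation.Propositional using (↭-sym; ↭⇒↭ₛ)
open import Data.List.Relation.Binary.Permutation.Propositional.Properties using (map⁺; ↭-length)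
open import Data.List.Relation.Binary.Permutation.Setoid.Properties using (Unique-resp-↭)
open import Data.List.Relation.Unary.All as All using (All; []; _∷_)
open import Data.List.Relation.Unary.All.Properties using (¬Any⇒All¬; All¬⇒¬Any)
open import Data.List.Relation.Unary.AllPairs using ([]; _∷_)
open import Data.List.Relation.Unary.Any using (here; there)
open import Data.List.Relation.Unary.Linked as Linked using (Linked; _∷_)
open import Data.List.Relation.Unary.Linked.Properties using (AllPairs⇒Linked)
open import Data.List.Relation.Unary.Unique.Propositional using (Unique)
open import Data.List.Relation.Unary.Unique.Propositional.Properties using (allFin⁺; filter⁺)
import Data.List.Sort as Sort
open import Data.Nat.Base as ℕ using (ℕ; zero; suc; z≤n; s≤s; _≤_; _<_; ∣_-_∣)
import Data.Nat.ListAction as ListAction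
import Data.Nat.ListAction.Properties as ListAction
import Data.Nat.Properties as ℕ
open import Data.Nat.Tactic.RingSolver using (solve-∀)
open import Data.Product.Base using (_×_; _,_; proj₁; proj₂; ∃-syntax)
open import Data.Sum.Base using (_⊎_; inj₁; inj₂)
open import Function.Base using (_∘_; id)
open import Relation.Binary.Construct.Closure.ReflexiveTransitive using (ε; _◅_)
import Relation.Binary.Construct.On as On
open import Relation.Binary.PropositionalEquality
open import Relation.Nullary using (Dec; does; ¬_; yes; no; contradiction)

-- Maxima, sums and duplicate-free lists.

maximum-< : ∀ {n m} (f : Fin n → ℕ) → 0 < m → (∀ i → f i < m) → maximum f < m
maximum-< {zero}  f 0<m f<m = 0<m
maximum-< {suc n} f 0<m f<m = ℕ.⊔-pres-<m (f<m zero) (maximum-< (f ∘ suc) 0<m (f<m ∘ suc))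

sum-tabulate : ∀ {n} (f : Fin n → ℕ) →
               ListAction.sum (List.tabulate f) ≡ sum ℕ.+-0-commutativeMonoid f
sum-tabulate {zero}  f = refl
sum-tabulate {suc n} f = cong (f zero ℕ.+_) (sum-tabulate (f ∘ suc))

∉⇒Unique-∷ : ∀ {A : Set} {x : A} {xs} → x ∉ xs → Unique xs → Unique (x ∷ xs)
∉⇒Unique-∷ x∉xs xs! = ¬Any⇒All¬ _ x∉xs ∷ xs!

Unique-∷⇒∉ : ∀ {A : Set} {x : A} {xs} → Unique (x ∷ xs) → x ∉ xs
Unique-∷⇒∉ (x≢xs ∷ _) = All¬⇒¬Any x≢xs

Unique-tail : ∀ {A : Set} {x : A} {xs} → Unique (x ∷ xs) → Unique xs
Unique-tail (_ ∷ xs!) = xs!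

-- Walks and paths in a graph.

module Walks {n} (G : Graph n) where
  open Graph G
  open DecMembership (Fin._≟_ {n}) using (_∈?_)

  private variable u v w x y z : Fin n

  end∈vertices : (p : Walk u v) → v ∈ vertices p
  end∈vertices ε       = here refl
  end∈vertices (_ ◅ p) = there (end∈vertices p)

  start∈vertices : (p : Walk u v) → u ∈ vertices p
  start∈vertices ε       = here refl
  start∈vertices (_ ◅ _) = here refl

  prefix : (p : Walk u v) → z ∈ vertices p → Walk u z
  prefix ε       (here refl) = ε
  prefix (_ ◅ _) (here refl) = ε
  prefix (e ◅ p) (there z∈p) = e ◅ prefix p z∈p

  All-prefix : ∀ {P : Fin n → Set} (p : Walk u v) (z∈p : z ∈ vertices p) →
               All P (vertices p) → All P (vertices (prefix p z∈p))
  All-prefix ε       (here refl) ps       = ps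
  All-prefix (_ ◅ _) (here refl) (p ∷ _)  = p ∷ []
  All-prefix (_ ◅ p) (there z∈p) (q ∷ ps) = q ∷ All-prefix p z∈p ps

  prefix-isPath : (p : Walk u v) (z∈p : z ∈ vertices p) → IsPath p → IsPath (prefix p z∈p)
  prefix-isPath ε       (here refl) p!        = p!
  prefix-isPath (_ ◅ _) (here refl) p!        = [] ∷ []
  prefix-isPath (_ ◅ p) (there z∈p) (u≢ ∷ p!) = All-prefix p z∈p u≢ ∷ prefix-isPath p z∈p p!

  suffix : (p : Walk u v) → IsPath p → z ∈ vertices p →
           ∃[ q ] IsPath {z} {v} q × length q ≤ length p
  suffix p@ε       p!       (here refl) = p , p! , ℕ.≤-refl
  suffix p@(_ ◅ _) p!       (here refl) = p , p! , ℕ.≤-refl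
  suffix (_ ◅ p)   (_ ∷ p!) (there z∈p) =
    let q , q! , q≤p = suffix p p! z∈p in q , q! , ℕ.m≤n⇒m≤1+n q≤p

  -- Loop erasure: when the new start already lies on the path built from the rest, only the part
  -- from that occurrence on is kept.
  walk⇒path : (p : Walk u v) → ∃[ q ] IsPath {u} {v} q × length q ≤ length p
  walk⇒path ε = ε , [] ∷ [] , z≤n
  walk⇒path {u} (e ◅ p) with walk⇒path p
  ... | q , q! , q≤p with u ∈? vertices q
  ...   | yes u∈q = let r , r! , r≤q = suffix q q! u∈q in
                    r , r! , ℕ.m≤n⇒m≤1+n (ℕ.≤-trans r≤q q≤p)
  ...   | no  u∉q = e ◅ q , ∉⇒Unique-∷ u∉q q! , s≤s q≤p

  infixr 5 _ʳ◅◅_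
  -- Reverses the first walk edge by edge onto the front of the second, so that walks with a common
  -- start can be joined.
  _ʳ◅◅_ : Walk u v → Walk u w → Walk v w
  ε       ʳ◅◅ q = q
  (e ◅ p) ʳ◅◅ q = p ʳ◅◅ (~-sym e ◅ q)

  length-ʳ◅◅ : (p : Walk u v) (q : Walk u w) → length (p ʳ◅◅ q) ≡ length p ℕ.+ length q
  length-ʳ◅◅ ε       q = refl
  length-ʳ◅◅ (e ◅ p) q = trans (length-ʳ◅◅ p (~-sym e ◅ q)) (ℕ.+-suc (length p) (length q))

  -- Uniqueness of paths in an acyclic graph.

  module _ (acyclic : Acyclic) where

    -- If `z` came later, the part of the path from `u` to `z` would have length at least 2, and the
    -- edge back to `u` would close a cycle.
    neighbour-on-path : (e : u ~ x) (p : Walk x v) → IsPath (e ◅ p) →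
                        z ∈ vertices p → z ~ u → z ≡ x
    neighbour-on-path e ε       p! (here z≡x) z~u = z≡x
    neighbour-on-path e (f ◅ p) p! (here z≡x) z~u = z≡x
    neighbour-on-path e (f ◅ p) p! (there z∈p) z~u =
      contradiction z~u
        (acyclic (e ◅ f ◅ prefix p z∈p)
          (prefix-isPath (e ◅ f ◅ p) (there (there z∈p)) p!) (s≤s (s≤s z≤n)))

    -- Vertex lists are compared because `_~_` may have several proofs for one edge, so the walks
    -- themselves can differ as terms.
    path-unique : (p q : Walk u v) → IsPath p → IsPath q → vertices p ≡ vertices q
    path-unique ε       ε       _  _  = refl
    path-unique ε       (_ ◅ q) _  q! = contradiction (end∈vertices q) (Unique-∷⇒∉ q!)
    path-unique (_ ◅ p) ε       p! _  = contradiction (end∈vertices p) (Unique-∷⇒∉ p!)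
    path-unique {u} (e ◅ p) (_◅_ {j = y} f q) p! q! with y ∈? vertices p
    ... | yes y∈p with refl ← neighbour-on-path e p p! y∈p (~-sym f) =
      cong (u ∷_) (path-unique p q (Unique-tail p!) (Unique-tail q!))
    -- Prepending `y` to the first path gives a path from `y` through `u` to `v`. By induction it
    -- has the vertices of `q`, so `u` would lie on `q`. The first path grows here; the recursion
    -- descends on the second.
    ... | no y∉p = contradiction
      (subst (u ∈_) (path-unique (~-sym f ◅ e ◅ p) q y∷p! (Unique-tail q!)) (there (here refl)))
      (Unique-∷⇒∉ q!)
      where
      y∷p! : IsPath (~-sym f ◅ e ◅ p)
      y∷p! = ∉⇒Unique-∷ (λ { (here refl) → ~-irrefl _ f ; (there y∈p) → y∉p y∈p }) p!

    -- Two paths leaving y along different edges share only y.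
    ʳ◅◅-isPath : (e : y ~ w) (p : Walk w v) (f : y ~ z) (q : Walk z x) →
                 IsPath (e ◅ p) → IsPath (f ◅ q) → z ≢ w → IsPath ((f ◅ q) ʳ◅◅ (e ◅ p))
    ʳ◅◅-isPath {y = y} {w = w} {z = z} e p f q p! q! z≢w = go q q!
      where
      z∷p! : IsPath (~-sym f ◅ e ◅ p)
      z∷p! = ∉⇒Unique-∷
        (λ { (here refl) → ~-irrefl _ f
           ; (there z∈p) → z≢w (neighbour-on-path e p p! z∈p (~-sym f)) }) p!

      go : (q : Walk z x) → IsPath (f ◅ q) → IsPath (q ʳ◅◅ (~-sym f ◅ e ◅ p))
      go ε       _  = z∷p!
      go (g ◅ q) q! = ʳ◅◅-isPath (~-sym f) (e ◅ p) g q z∷p! (Unique-tail q!)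
        (λ { refl → Unique-∷⇒∉ q! (there (start∈vertices q)) })

-- The detour distance of a tree as a metric.

module TreeDistance {n} (T : Tree n) where
  open Tree T
  open Walks graph
  open DecMembership (Fin._≟_ {n}) using (_∈?_)

  -- The maximum defining `D` ranges over a single length, since any two paths with the same ends
  -- have the same vertices.
  D-path : ∀ {u v} (p : Walk u v) → IsPath p → D u v ≡ length p
  D-path {u} {v} p p! =
    let q , q! , ∣q∣≡D = proj₁ (proj₂ (D-exists u v)) in
    trans (sym ∣q∣≡D) (ℕ.suc-injective (begin
      suc (length q)           ≡⟨ length-vertices q ⟨
      List.length (vertices q) ≡⟨ cong List.length (path-unique acyclic q p q! p!) ⟩
      List.length (vertices p) ≡⟨ length-vertices p ⟩
      suc (length p)           ∎))
    where open ≡-Reasoning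

  -- Loop erasure yields a path no longer than the walk, and every path has length `D u v`.
  D≤length : ∀ {u v} (p : Walk u v) → D u v ≤ length p
  D≤length p = let q , q! , q≤p = walk⇒path p in
    ℕ.≤-trans (ℕ.≤-reflexive (D-path q q!)) q≤p

  geodesic : ∀ u v → ∃[ p ] IsPath {u} {v} p × length p ≡ D u v
  geodesic u v = proj₁ (proj₂ (D-exists u v))

  D-refl : ∀ u → D u u ≡ 0
  D-refl u = ℕ.n≤0⇒n≡0 (D≤length ε)

  -- With the common vertex `u` as first argument of both distances, the paths join without symmetry
  -- of `D`; symmetry is then the case `w = u`.
  D-triangle : ∀ u v w → D v w ≤ D u v ℕ.+ D u w
  D-triangle u v w with geodesic u v | geodesic u w
  ... | p , _ , ∣p∣≡D | q , _ , ∣q∣≡D = begin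
    D v w                    ≤⟨ D≤length (p ʳ◅◅ q) ⟩
    length (p ʳ◅◅ q)         ≡⟨ length-ʳ◅◅ p q ⟩
    length p ℕ.+ length q    ≡⟨ cong₂ ℕ._+_ ∣p∣≡D ∣q∣≡D ⟩
    D u v ℕ.+ D u w          ∎
    where open ℕ.≤-Reasoning

  D-sym-≤ : ∀ u v → D v u ≤ D u v
  D-sym-≤ u v = subst (D v u ≤_) (trans (cong (D u v ℕ.+_) (D-refl u)) (ℕ.+-identityʳ _))
    (D-triangle u v u)

  D-positive : ∀ {u v} → u ≢ v → 1 ≤ D u v
  D-positive {u} {v} u≢v with geodesic u v
  ... | ε     , _ , _     = contradiction refl u≢v
  ... | _ ◅ _ , _ , ∣p∣≡D = subst (1 ≤_) ∣p∣≡D (s≤s z≤n)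

  -- Eccentricity and the center.

  D≤eccentricity : ∀ u v → D u v ≤ eccentricity u
  D≤eccentricity u = ≤-maximum (D u)

  -- If w and w′ were central at distance at least 2, the neighbour x of w
  -- towards w′ would be closer than w or w′ to every vertex.
  central-adjacent : ∀ {w w′} → Central w → Central w′ → w ≡ w′ ⊎ w ~ w′
  central-adjacent {w} {w′} cw cw′ with connected w w′
  ... | _ , ε     , _ = inj₁ refl
  ... | _ , e ◅ ε , _ = inj₂ e
  ... | _ , _◅_ {j = x} e (f ◅ p) , p! , _ =
    contradiction (cw x) (ℕ.<⇒≱ (maximum-< (D x) (ℕ.≤-<-trans z≤n (closer x)) closer))
    where
    open ℕ.≤-Reasoning
    closer : ∀ v → D x v < eccentricity w
    closer v with geodesic w v
    ... | r , r! , ∣r∣≡D with x ∈? vertices r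
    closer v | ε     , r! , ∣r∣≡D | yes (here refl) = contradiction e (~-irrefl _)
    closer v | g ◅ r , r! , ∣r∣≡D | yes (here refl) = contradiction e (~-irrefl _)
    closer v | g ◅ r , r! , ∣r∣≡D | yes (there x∈r)
      with refl ← neighbour-on-path acyclic g r r! x∈r (~-sym e) = begin-strict
      D x v          ≤⟨ D≤length r ⟩
      length r       <⟨ ℕ.n<1+n _ ⟩
      length (g ◅ r) ≡⟨ ∣r∣≡D ⟩
      D w v          ≤⟨ D≤eccentricity w v ⟩
      eccentricity w ∎
    ... | no x∉r = begin-strict
      D x v                                   ≤⟨ D≤length x∷r ⟩
      length x∷r                              <⟨ ℕ.m<n+m _ (s≤s z≤n) ⟩
      length (f ◅ p) ℕ.+ length x∷r           ≡⟨ length-ʳ◅◅ (f ◅ p) x∷r ⟨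
      length ((f ◅ p) ʳ◅◅ x∷r)                ≡⟨ D-path ((f ◅ p) ʳ◅◅ x∷r) joined! ⟨
      D w′ v                                  ≤⟨ D≤eccentricity w′ v ⟩
      eccentricity w′                         ≤⟨ cw′ w ⟩
      eccentricity w                          ∎
      where
      x∷r = ~-sym e ◅ r
      joined! : IsPath ((f ◅ p) ʳ◅◅ x∷r)
      joined! = ʳ◅◅-isPath acyclic (~-sym e) r f p (∉⇒Unique-∷ x∉r r!) (Unique-tail p!)
        (λ { refl → Unique-∷⇒∉ p! (there (start∈vertices p)) })

  no-triangle : ∀ {a b c} → a ~ b → b ~ c → a ≢ c → ¬ (c ~ a)
  no-triangle e f a≢c = acyclic (e ◅ f ◅ ε)
    (((λ { refl → ~-irrefl _ e }) ∷ a≢c ∷ []) ∷ ((λ { refl → ~-irrefl _ f }) ∷ []) ∷ [] ∷ [])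
    (s≤s (s≤s z≤n))

  -- Any three distinct central vertices would be pairwise adjacent and form a triangle, so a list
  -- of central vertices whose length is not 2 has at most one entry.
  central-unique : ∀ xs → Unique xs → (∀ {w} → w ∈ xs → Central w) → List.length xs ≢ 2 →
                 ∀ {w w′} → w ∈ xs → w′ ∈ xs → w ≡ w′
  central-unique (_ ∷ [])     _ _ _   (here refl) (here refl) = refl
  central-unique (_ ∷ _ ∷ []) _ _ l≢2 _           _           = contradiction refl l≢2
  central-unique (a ∷ b ∷ c ∷ _) ((a≢b ∷ a≢c ∷ _) ∷ (b≢c ∷ _) ∷ _) central _ _ _
    with central-adjacent (central (here refl)) (central (there (here refl)))
       | central-adjacent (central (there (here refl))) (central (there (there (here refl))))
       | central-adjacent (central (there (there (here refl)))) (central (here refl))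
  ... | inj₁ a≡b | _        | _        = contradiction a≡b a≢b
  ... | inj₂ _   | inj₁ b≡c | _        = contradiction b≡c b≢c
  ... | inj₂ _   | inj₂ _   | inj₁ c≡a = contradiction (sym c≡a) a≢c
  ... | inj₂ a~b | inj₂ b~c | inj₂ c~a = contradiction c~a (no-triangle a~b b~c a≢c)

  ≡⇒D≤ : ∀ {u v k} → u ≡ v → D u v ≤ k
  ≡⇒D≤ {u} refl = ℕ.≤-trans (D≤length {u} ε) z≤n

  D-central : ∀ {w w′} → Central w → Central w′ → D w w′ ≤ εᵀ
  D-central {w} {w′} cw cw′ = bound (List.length center ℕ.≟ 2)
    where
    -- The decision is made an argument so that the `if` inside `εᵀ` reduces in each case.
    bound : (two? : Dec (List.length center ≡ 2)) → D w w′ ≤ (if does two? then 1 else 0)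
    bound (yes _) with central-adjacent cw cw′
    ... | inj₁ w≡w′ = ≡⇒D≤ w≡w′
    ... | inj₂ w~w′ = D≤length (w~w′ ◅ ε)
    bound (no l≢2) = ≡⇒D≤ (central-unique center (filter⁺ central? (allFin⁺ n))
      (proj₂ ∘ ∈-filter⁻ central? {xs = allFin n}) l≢2
      (∈-filter⁺ central? (∈-allFin w) cw) (∈-filter⁺ central? (∈-allFin w′) cw′))

  -- The central vertices nearest to `u` and to `v` may differ; `εᵀ` pays for the passage between
  -- them.
  D-via-center : ∀ u v {w w′} → Central w → Central w′ →
                 D u v ≤ D u w ℕ.+ D v w′ ℕ.+ εᵀ
  D-via-center u v {w} {w′} cw cw′ = begin
    D u v                             ≤⟨ D-triangle w u v ⟩
    D w u ℕ.+ D w v                   ≤⟨ ℕ.+-mono-≤ (D-sym-≤ u w) (D-triangle w′ w v) ⟩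
    D u w ℕ.+ (D w′ w ℕ.+ D w′ v)     ≤⟨ ℕ.+-monoʳ-≤ (D u w) (ℕ.+-mono-≤ (D-central cw′ cw) (D-sym-≤ v w′)) ⟩
    D u w ℕ.+ (εᵀ ℕ.+ D v w′)         ≡⟨ cong (D u w ℕ.+_) (ℕ.+-comm εᵀ (D v w′)) ⟩
    D u w ℕ.+ (D v w′ ℕ.+ εᵀ)         ≡⟨ ℕ.+-assoc (D u w) (D v w′) εᵀ ⟨
    D u w ℕ.+ D v w′ ℕ.+ εᵀ           ∎
    where open ℕ.≤-Reasoning

  -- Bounds in terms of levels.

  level-attained : ∀ u → DistanceToCentral u (level u)
  level-attained u = proj₁ (proj₂ (level-exists u))

  D≤level+level+ε : ∀ u v → D u v ≤ level u ℕ.+ level v ℕ.+ εᵀ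
  D≤level+level+ε u v =
    let w  , cw  , Duw≡  = level-attained u
        w′ , cw′ , Dvw′≡ = level-attained v in
    subst₂ (λ a b → D u v ≤ a ℕ.+ b ℕ.+ εᵀ) Duw≡ Dvw′≡ (D-via-center u v cw cw′)

  -- With a single central vertex, two distinct vertices cannot both have level 0.
  ε′≤level+level : ∀ {u v} → u ≢ v → εᵀ′ ≤ level u ℕ.+ level v
  ε′≤level+level {u} {v} u≢v = ℕ.m≤n+o⇒m∸n≤o 1 εᵀ
    (subst (1 ≤_) (ℕ.+-comm (level u ℕ.+ level v) εᵀ)
      (ℕ.≤-trans (D-positive u≢v) (D≤level+level+ε u v)))

-- The telescoping sum along a list.

module Telescope {A : Set} (c l : A → ℕ) (m e : ℕ) where

  -- The inequality c(y) - c(x) ≥ m - (l(x) + l(y) + e), with all terms moved so that no truncated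
  -- subtraction occurs.
  Step : A → A → Set
  Step x y = m ℕ.+ c x ≤ l x ℕ.+ l y ℕ.+ e ℕ.+ c y

  total : List A → ℕ
  total xs = ListAction.sum (List.map l xs)

  -- Here `z` is the last entry. Adding `l x` and `l z` on the left completes the double count of
  -- levels at the two ends; `z ∈ y ∷ ys` serves to tell `z` from `x` later.
  telescope : ∀ x y ys → Linked Step (x ∷ y ∷ ys) → ∃[ z ] z ∈ y ∷ ys ×
    suc (List.length ys) ℕ.* m ℕ.+ c x ℕ.+ (l x ℕ.+ l z) ≤
    2 ℕ.* total (x ∷ y ∷ ys) ℕ.+ suc (List.length ys) ℕ.* e ℕ.+ c z
  telescope x y [] (step ∷ _) = y , here refl , (begin
    1 ℕ.* m ℕ.+ c x ℕ.+ (l x ℕ.+ l y)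
      ≡⟨ cong (λ k → k ℕ.+ c x ℕ.+ (l x ℕ.+ l y)) (ℕ.*-identityˡ m) ⟩
    m ℕ.+ c x ℕ.+ (l x ℕ.+ l y)
      ≤⟨ ℕ.+-monoˡ-≤ _ step ⟩
    l x ℕ.+ l y ℕ.+ e ℕ.+ c y ℕ.+ (l x ℕ.+ l y)
      ≡⟨ rearrange (l x) (l y) e (c y) ⟩
    2 ℕ.* (l x ℕ.+ (l y ℕ.+ 0)) ℕ.+ 1 ℕ.* e ℕ.+ c y ∎)
    where
    open ℕ.≤-Reasoning
    rearrange : ∀ a b e d → a ℕ.+ b ℕ.+ e ℕ.+ d ℕ.+ (a ℕ.+ b) ≡
                2 ℕ.* (a ℕ.+ (b ℕ.+ 0)) ℕ.+ 1 ℕ.* e ℕ.+ d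
    rearrange = solve-∀
  telescope x y (y′ ∷ ys) (step ∷ steps) with telescope y y′ ys steps
  ... | z , z∈ys , ih = z , there z∈ys ,
    -- Adding the first step to the induction hypothesis leaves two common terms: `c y` telescopes,
    -- and the `l y` of the step replaces the end correction at `y`, which has become an interior
    -- vertex.
    ℕ.+-cancelʳ-≤ (c y ℕ.+ l y) _ _ (begin
      suc k ℕ.* m ℕ.+ c x ℕ.+ (l x ℕ.+ l z) ℕ.+ (c y ℕ.+ l y)
        ≡⟨ split k m (c x) (l x) (l z) (c y) (l y) ⟩
      (m ℕ.+ c x) ℕ.+ l x ℕ.+ (k ℕ.* m ℕ.+ c y ℕ.+ (l y ℕ.+ l z))
        ≤⟨ ℕ.+-mono-≤ (ℕ.+-monoˡ-≤ (l x) step) ih ⟩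
      (l x ℕ.+ l y ℕ.+ e ℕ.+ c y) ℕ.+ l x ℕ.+ (2 ℕ.* t ℕ.+ k ℕ.* e ℕ.+ c z)
        ≡⟨ merge k e (l x) (l y) (c y) t (c z) ⟩
      2 ℕ.* (l x ℕ.+ t) ℕ.+ suc k ℕ.* e ℕ.+ c z ℕ.+ (c y ℕ.+ l y) ∎)
    where
    open ℕ.≤-Reasoning
    k = suc (List.length ys)
    t = total (y ∷ y′ ∷ ys)
    split : ∀ k m cx lx lz cy ly →
      suc k ℕ.* m ℕ.+ cx ℕ.+ (lx ℕ.+ lz) ℕ.+ (cy ℕ.+ ly) ≡
      (m ℕ.+ cx) ℕ.+ lx ℕ.+ (k ℕ.* m ℕ.+ cy ℕ.+ (ly ℕ.+ lz))
    split = solve-∀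
    merge : ∀ k e lx ly cy t cz →
      (lx ℕ.+ ly ℕ.+ e ℕ.+ cy) ℕ.+ lx ℕ.+ (2 ℕ.* t ℕ.+ k ℕ.* e ℕ.+ cz) ≡
      2 ℕ.* (lx ℕ.+ t) ℕ.+ suc k ℕ.* e ℕ.+ cz ℕ.+ (cy ℕ.+ ly)
    merge = solve-∀

  telescope-unique : ∀ {r h} xs → 2 ≤ List.length xs → Linked Step xs → Unique xs →
    (∀ {x z} → x ≢ z → r ≤ l x ℕ.+ l z) → (∀ z → c z ≤ h) →
    (List.length xs ℕ.∸ 1) ℕ.* m ℕ.+ r ≤
    2 ℕ.* total xs ℕ.+ (List.length xs ℕ.∸ 1) ℕ.* e ℕ.+ h
  telescope-unique {r} {h} (x ∷ y ∷ ys) _ steps (x≢ ∷ _) r≤l+l c≤h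
    with telescope x y ys steps
  ... | z , z∈ys , bound = begin
    -- The first color is at least 0, and the two ends are distinct because `x` does not recur in
    -- the tail.
    k ℕ.* m ℕ.+ r                                        ≤⟨ ℕ.+-mono-≤ (ℕ.m≤m+n _ (c x)) (r≤l+l (All.lookup x≢ z∈ys)) ⟩
    k ℕ.* m ℕ.+ c x ℕ.+ (l x ℕ.+ l z)                    ≤⟨ bound ⟩
    2 ℕ.* total (x ∷ y ∷ ys) ℕ.+ k ℕ.* e ℕ.+ c z         ≤⟨ ℕ.+-monoʳ-≤ _ (c≤h z) ⟩
    2 ℕ.* total (x ∷ y ∷ ys) ℕ.+ k ℕ.* e ℕ.+ h           ∎
    where
    open ℕ.≤-Reasoning
    k = suc (List.length ys)
  telescope-unique (_ ∷ []) (s≤s ())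

-- Vertices ordered by color.

module Coloring {n} (T : Tree n) (c : Fin n → ℕ) (ham : Tree.IsHamiltonianColoring T c) where
  open Tree T
  open TreeDistance T
  open Telescope c level (n ℕ.∸ 1) εᵀ
  open Sort (On.decTotalOrder ℕ.≤-decTotalOrder c) using (sort; sort-↭; sort-↗)

  ordered : List (Fin n)
  ordered = sort (allFin n)

  ordered-unique : Unique ordered
  ordered-unique = Unique-resp-↭ (setoid _) (↭⇒↭ₛ (↭-sym (sort-↭ (allFin n)))) (allFin⁺ n)

  length-ordered : List.length ordered ≡ n
  length-ordered = trans (↭-length (sort-↭ (allFin n))) (length-tabulate id)

  total-ordered : total ordered ≡ totalLevel
  total-ordered = begin
    total ordered                     ≡⟨ ListAction.sum-↭ (map⁺ level (sort-↭ (allFin n))) ⟩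
    total (allFin n)                  ≡⟨ cong ListAction.sum (map-tabulate id level) ⟩
    ListAction.sum (List.tabulate level)    ≡⟨ sum-tabulate level ⟩
    totalLevel                        ∎
    where open ≡-Reasoning

  -- For increasing colors the absolute value is a true difference, so adding `c x` to it gives
  -- `c y`; the level bound then replaces `D x y`.
  step : ∀ {x y} → c x ≤ c y × x ≢ y → Step x y
  step {x} {y} (cx≤cy , x≢y) = begin
    n ℕ.∸ 1 ℕ.+ c x                            ≤⟨ ℕ.+-monoˡ-≤ (c x) (ham x y x≢y) ⟩
    D x y ℕ.+ ∣ c x - c y ∣ ℕ.+ c x            ≡⟨ ℕ.+-assoc (D x y) _ (c x) ⟩
    D x y ℕ.+ (∣ c x - c y ∣ ℕ.+ c x)          ≡⟨ cong (λ k → D x y ℕ.+ (k ℕ.+ c x)) (ℕ.m≤n⇒∣m-n∣≡n∸m cx≤cy) ⟩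
    D x y ℕ.+ (c y ℕ.∸ c x ℕ.+ c x)            ≡⟨ cong (D x y ℕ.+_) (ℕ.m∸n+n≡m cx≤cy) ⟩
    D x y ℕ.+ c y                              ≤⟨ ℕ.+-monoˡ-≤ (c y) (D≤level+level+ε x y) ⟩
    level x ℕ.+ level y ℕ.+ εᵀ ℕ.+ c y         ∎
    where open ℕ.≤-Reasoning

  steps : Linked Step ordered
  steps = Linked.zipWith step (sort-↗ (allFin n) , AllPairs⇒Linked ordered-unique)

  maximum-bound : n ℕ.≥ 2 →
    (n ℕ.∸ 1) ℕ.* (n ℕ.∸ 1) ℕ.+ εᵀ′ ≤ 2 ℕ.* totalLevel ℕ.+ (n ℕ.∸ 1) ℕ.* εᵀ ℕ.+ maximum c
  -- The telescoped bound speaks of the sorted list; its length is replaced by `n` and its sum of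
  -- levels by `totalLevel`.
  maximum-bound n≥2 = subst₂
    (λ k t → (k ℕ.∸ 1) ℕ.* (n ℕ.∸ 1) ℕ.+ εᵀ′ ≤ 2 ℕ.* t ℕ.+ (k ℕ.∸ 1) ℕ.* εᵀ ℕ.+ maximum c)
    length-ordered total-ordered
    (telescope-unique ordered (subst (2 ≤_) (sym length-ordered) n≥2) steps ordered-unique
      ε′≤level+level (≤-maximum c))

-- Passage to the integers and conclusion.

integer-bound : ∀ m e e′ l h → m ℕ.* m ℕ.+ e′ ≤ 2 ℕ.* l ℕ.+ m ℕ.* e ℕ.+ h →
                + h ≥ + m * (+ m - + e) + + e′ - + 2 * + l
integer-bound m e e′ l h bound = begin
  + m * (+ m - + e) + + e′ - + 2 * + l
    ≡⟨ lhs (+ m) (+ e) (+ e′) (+ l) ⟩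
  (+ m * + m + + e′) - (+ 2 * + l + + m * + e)
    ≡⟨ cong₂ (λ a b → (a + + e′) - b) (ℤ.pos-* m m) (cong₂ _+_ (ℤ.pos-* 2 l) (ℤ.pos-* m e)) ⟨
  + (m ℕ.* m ℕ.+ e′) - + (2 ℕ.* l ℕ.+ m ℕ.* e)
    ≤⟨ ℤ.+-monoˡ-≤ (ℤ.- + (2 ℕ.* l ℕ.+ m ℕ.* e)) (ℤ.+≤+ bound) ⟩
  + (2 ℕ.* l ℕ.+ m ℕ.* e ℕ.+ h) - + (2 ℕ.* l ℕ.+ m ℕ.* e)
    ≡⟨ rhs (+ (2 ℕ.* l ℕ.+ m ℕ.* e)) (+ h) ⟩
  + h ∎
  where
  open ℤ.≤-Reasoning
  lhs : ∀ m e e′ l → m * (m - e) + e′ - + 2 * l ≡ (m * m + e′) - (+ 2 * l + m * e)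
  lhs = ℤ-Solver.solve-∀
  rhs : ∀ a h → (a + h) - a ≡ h
  rhs = ℤ-Solver.solve-∀

theorem4 : (n : ℕ) (T : Tree n) → n ℕ.≥ 4 → Tree.Δ T ℕ.≥ 3 →
    let open Tree T in
    + hc ≥ (+ n - 1ℤ) * (+ n - 1ℤ - + εᵀ) + + εᵀ′ - + 2 * + totalLevel
theorem4 (suc m) T n≥4 _ =
  let open Tree T
      c , ham , max≡hc = proj₁ (proj₂ hc-exists) in
  -- With `n = suc m`, both `n ∸ 1` and `+ n - 1ℤ` compute to `m`. The coloring `c` is one that
  -- attains `hc`.
  integer-bound m εᵀ εᵀ′ totalLevel hc
    (subst (λ h → m ℕ.* m ℕ.+ εᵀ′ ≤ 2 ℕ.* totalLevel ℕ.+ m ℕ.* εᵀ ℕ.+ h) max≡hc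
      (Coloring.maximum-bound T c ham (ℕ.≤-trans (s≤s (s≤s z≤n)) n≥4)))
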